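{- Let $A=(1,a_1,\ldots,a_k)$ be an orderly currency. Then for every $2\leq l\leq k$ the currency $(1,a_1,a_l)$ is orderly. In particular (when $k\geq 2$) the currency $(1,a_1,a_2)$ is orderly.
   Context: A currency is a finite sequence of integers $A=(a_0,a_1,\ldots,a_k)$ with $1=a_0<a_1<\cdots<a_k$. For an integer amount $c>0$, $\mathrm{opt}_A(c)$ is the minimum number of coins (values from $A$, repetitions allowed) summing to $c$, and $\mathrm{grd}_A(c)$ is the number of coins used by the greedy algorithm, which repeatedly takes the largest coin not exceeding the remaining amount. $A$ is orderly if $\mathrm{opt}_A(c)=\mathrm{grd}_A(c)$ for all integers $c>0$. -}

module Defs where

open import Data.Nat using (ℕ; zero; suc; _+_; _∸_; _≤_; _<_; _≤?_)
open import Data.List using (List; []; _∷_; length)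
open import Data.Nat.ListAction using (sum)
open import Data.List.Membership.Propositional using (_∈_)
open import Data.List.Relation.Unary.All using (All)
open import Data.List.Relation.Unary.Linked using (Linked)
open import Data.Product using (Σ; _×_)
open import Relation.Binary.PropositionalEquality using (_≡_)
open import Relation.Nullary using (yes; no)

IsCurrency : List ℕ → Set
IsCurrency []      = Data.Empty.⊥ where import Data.Empty
IsCurrency (a ∷ as) = (a ≡ 1) × Linked _<_ (a ∷ as)

Rep : List ℕ → ℕ → List ℕ → Set
Rep A c cs = All (_∈ A) cs × (sum cs ≡ c)

IsOpt : List ℕ → ℕ → ℕ → Set
IsOpt A c n = Σ (List ℕ) (λ cs → Rep A c cs × length cs ≡ n)
            × (∀ cs → Rep A c cs → n ≤ length cs)

-- Largest coin of A not exceeding r (0 if none).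
largest≤ : List ℕ → ℕ → ℕ
largest≤ []       r = 0
largest≤ (a ∷ as) r with a ≤? r
... | yes _ = aux (largest≤ as r)
  where aux : ℕ → ℕ
        aux zero = a
        aux (suc m) = suc m
... | no  _ = largest≤ as r

-- Greedy coin count with explicit fuel; each step removes a coin >= 1
-- (for a currency), so fuel c suffices for amount c.
grdFuel : ℕ → List ℕ → ℕ → ℕ
grdFuel zero     A r = 0
grdFuel (suc f) A zero = 0
grdFuel (suc f) A (suc r) = suc (grdFuel f A (suc r ∸ largest≤ A (suc r)))

grd : List ℕ → ℕ → ℕ
grd A c = grdFuel c A c

Orderly : List ℕ → Set
Orderly A = ∀ c → 0 < c → IsOpt A c (grd A c)

{-# OPTIONS --safe #-}
module Submission where

-- Put a = a₁ and write b = q a + r with 0 ≤ r < a. The currency (1, a, b) is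
-- orderly as soon as r = 0 or a ≤ q + r ("b is good"): the only amounts at which
-- greedy could lose are those where adding a coin a overflows past b.
-- Conversely, let A be orderly and b its smallest bad coin. If z = y + d is a coin,
-- y a coin, d < q a, and no coin lies strictly between z and z + q a, then
-- optimality at y + (⌊d/a⌋ + 1) a shows that d is almost good, and optimality at
-- y + b = z + (b − d) shows that b − d is a coin, hence good; adding the two makes b
-- good. So each coin y with a coin in (y, y + q a) is followed by a larger one of
-- the same kind; b is of this kind (optimality at (q + 1) a), and A would be infinite.

open import Defs
open import Data.Nat using (ℕ; zero; suc; _+_; _*_; _∸_; _≤_; _<_; _≤?_; _<?_; z≤n; s≤s; s≤s⁻¹; >-nonZero)
open import Data.Nat.DivMod using (_/_; _%_; m≡m%n+[m/n]*n; m%n<n)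
open import Data.Nat.Induction using (<-rec)
open import Data.Nat.ListAction using (sum)
open import Data.Nat.Properties
open import Algebra.Properties.CommutativeSemigroup +-commutativeSemigroup using (x∙yz≈y∙xz)
open import Data.Nat.Tactic.RingSolver using (solve-∀)
open import Data.Fin using (Fin; toℕ; zero; suc)
open import Data.Vec using (Vec; lookup; toList; _∷_)
open import Data.Vec.Membership.Propositional.Properties using (∈-lookup; ∈-toList⁺)
open import Data.List using (List; []; _∷_; length; replicate)
open import Data.List.Extrema.Nat using (max; xs≤max)
open import Data.List.Membership.Propositional using (_∈_; find; lose)
open import Data.List.Properties using (length-replicate)
open import Data.List.Relation.Unary.All as All using (All; []; _∷_)
open import Data.List.Relation.Unary.All.Properties using (replicate⁺)
open import Data.List.Relation.Unary.AllPairs as AllPairs using (AllPairs; []; _∷_)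
open import Data.List.Relation.Unary.Any using (Any; here; there; any?)
open import Data.List.Relation.Unary.Linked using (Linked; [-]; _∷_)
open import Data.List.Relation.Unary.Linked.Properties using (Linked⇒AllPairs)
open import Data.Product using (_×_; _,_; ∃; ∃₂; proj₁; proj₂; map₁)
open import Data.Sum using (_⊎_; inj₁; inj₂)
open import Data.Empty using (⊥; ⊥-elim)
open import Relation.Binary.Definitions using (tri<; tri≈; tri>)
open import Relation.Nullary using (¬_; yes; no; contradiction)
open import Relation.Nullary.Decidable using (_×-dec_)
open import Relation.Binary.PropositionalEquality using (_≡_; refl; sym; trans; cong; subst; subst₂; module ≡-Reasoning)

-- The greedy choice and the greedy count.

largest≤-∈ : ∀ A r {m} → largest≤ A r ≡ suc m → suc m ∈ A × suc m ≤ r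
largest≤-∈ (a ∷ A) r eq with a ≤? r
... | no _ = map₁ there (largest≤-∈ A r eq)
... | yes a≤r with largest≤ A r in eq′ | eq
...   | zero  | refl = here refl , a≤r
...   | suc _ | refl = map₁ there (largest≤-∈ A r eq′)

-- A nonzero answer from the tail overrides the head; it is a later coin, hence larger because the
-- list increases.
≤-largest≤ : ∀ {A r z} → AllPairs _<_ A → z ∈ A → z ≤ r → z ≤ largest≤ A r
≤-largest≤ {a ∷ A} {r} (a<A ∷ A↗) z∈ z≤r with a ≤? r | z∈
... | no a≰r  | here refl = contradiction z≤r a≰r
... | no _    | there z∈A = ≤-largest≤ A↗ z∈A z≤r
... | yes _   | here refl with largest≤ A r in eq
...   | zero  = ≤-refl
...   | suc _ = <⇒≤ (All.lookup a<A (proj₁ (largest≤-∈ A r eq)))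
≤-largest≤ {a ∷ A} {r} (a<A ∷ A↗) z∈ z≤r | yes _ | there z∈A
  with largest≤ A r | ≤-largest≤ A↗ z∈A z≤r
...   | zero  | z≤0 = ≤-trans z≤0 z≤n
...   | suc _ | z≤m = z≤m

-- For a coin `z`, the condition under which greedy at `z + v` takes `z` first.
Clear : List ℕ → ℕ → ℕ → Set
Clear A z v = ∀ {x} → x ∈ A → x ≤ z + v → x ≤ z

module Greedy (as : List ℕ) (sorted : Linked _<_ (1 ∷ as)) where

  A : List ℕ
  A = 1 ∷ as

  A↗ : AllPairs _<_ A
  A↗ = Linked⇒AllPairs <-trans sorted

  coin-positive : ∀ {x} → x ∈ A → 1 ≤ x
  coin-positive (here refl) = ≤-refl
  coin-positive (there x∈) = <⇒≤ (All.lookup (AllPairs.head A↗) x∈)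

  largest≤-positive : ∀ r → 1 ≤ largest≤ A (suc r)
  largest≤-positive r = ≤-largest≤ A↗ (here refl) (s≤s z≤n)

  remainder≤ : ∀ r → suc r ∸ largest≤ A (suc r) ≤ r
  remainder≤ r = ∸-monoʳ-≤ (suc r) (largest≤-positive r)

  largest≤-∈′ : ∀ r → largest≤ A (suc r) ∈ A × largest≤ A (suc r) ≤ suc r
  largest≤-∈′ r with largest≤ A (suc r) in eq | largest≤-positive r
  ... | suc _ | _ = largest≤-∈ A (suc r) eq

  -- Each step lowers the amount by at least one, so fuel no smaller than the amount never runs out.
  -- A recursive call inherits surplus fuel, whereas `grd` starts with fuel equal to the amount.
  grdFuel-irrelevant : ∀ f g r → r ≤ f → r ≤ g → grdFuel f A r ≡ grdFuel g A r
  grdFuel-irrelevant zero    zero    r       _ _ = refl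
  grdFuel-irrelevant zero    (suc g) zero    _ _ = refl
  grdFuel-irrelevant (suc f) zero    zero    _ _ = refl
  grdFuel-irrelevant (suc f) (suc g) zero    _ _ = refl
  grdFuel-irrelevant (suc f) (suc g) (suc r) (s≤s r≤f) (s≤s r≤g) =
    cong suc (grdFuel-irrelevant f g _
      (≤-trans (remainder≤ r) r≤f) (≤-trans (remainder≤ r) r≤g))

  largest≤-clear : ∀ {z v} → z ∈ A → Clear A z v → largest≤ A (z + v) ≡ z
  largest≤-clear {suc z} {v} z∈ clear = ≤-antisym
    (clear (proj₁ (largest≤-∈′ (z + v))) (proj₂ (largest≤-∈′ (z + v))))
    (≤-largest≤ A↗ z∈ (m≤m+n (suc z) v))
  largest≤-clear {zero} z∈ _ with () ← coin-positive z∈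

  grd-clear : ∀ {z v} → z ∈ A → Clear A z v → grd A (z + v) ≡ suc (grd A v)
  grd-clear {zero} z∈ _ with () ← coin-positive z∈
  grd-clear {suc z} {v} z∈ clear
    rewrite largest≤-clear {suc z} {v} z∈ clear | m+n∸m≡n z v =
    cong suc (grdFuel-irrelevant (z + v) v v (m≤n+m v z) ≤-refl)

  grdFuel-rep : ∀ f r → r ≤ f → ∃ λ cs → Rep A r cs × length cs ≡ grdFuel f A r
  grdFuel-rep zero    zero    _ = [] , ([] , refl) , refl
  grdFuel-rep (suc f) zero    _ = [] , ([] , refl) , refl
  grdFuel-rep (suc f) (suc r) (s≤s r≤f) =
    let m∈ , m≤ = largest≤-∈′ r
        cs , (cs⊆A , eq) , len = grdFuel-rep f _ (≤-trans (remainder≤ r) r≤f)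
        m = largest≤ A (suc r)
    in m ∷ cs , (m∈ ∷ cs⊆A , trans (cong (m +_) eq) (m+[n∸m]≡n m≤)) , cong suc len

  -- Greedy itself supplies a representation, so only the lower bound remains.
  orderly : (∀ c cs → Rep A c cs → grd A c ≤ length cs) → Orderly A
  orderly minimal c _ = grdFuel-rep c c ≤-refl , minimal c

  -- An optimal representation of z + v may be assumed to contain z.
  exchange : Orderly A → ∀ {z v cs} → z ∈ A → Clear A z v → Rep A (z + v) cs →
             ∃ λ ds → Rep A v ds × length ds < length cs
  exchange ord {z} {v} {cs} z∈ clear rep =
    let ds , rep-ds , len = grdFuel-rep v v ≤-refl
    in ds , rep-ds , (begin
      suc (length ds)   ≡⟨ cong suc len ⟩
      suc (grd A v)     ≡⟨ sym (grd-clear z∈ clear) ⟩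
      grd A (z + v)     ≤⟨ proj₂ (ord (z + v) (≤-trans (coin-positive z∈) (m≤m+n z v))) cs rep ⟩
      length cs         ∎)
    where open ≤-Reasoning

-- Good numbers and division by `a`.

-- For r ≠ 0 the amount (q + 1) a is b plus a − r units, so a ≤ q + r says that
-- greedy spends at most q + 1 coins on it.
Good : ℕ → ℕ → Set
Good a b = ∃₂ λ q r → b ≡ q * a + r × r < a × 0 < q × (r ≡ 0 ⊎ a ≤ q + r)

-- `Good` relaxed by one unit, with `q` allowed to be zero. The unit accounts for the extra coin `y`
-- in the representation of `y + (q + 1) a`.
WeaklyGood : ℕ → ℕ → Set
WeaklyGood a d = ∃₂ λ q r → d ≡ q * a + r × r < a × (r ≡ 0 ⊎ a ≤ suc (q + r))

-- If `d` has remainder 0, its quotient only helps. Otherwise the missing unit comes from `q′ > 0`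
-- when `r′` is 0, from the inequality for `e` when the remainders do not carry, and from the carry
-- into the quotient when they do.
weaklyGood+good⇒good : ∀ {a d e} → WeaklyGood a d → Good a e → Good a (d + e)
weaklyGood+good⇒good {a} (q , .0 , refl , _ , inj₁ refl) (q′ , r′ , refl , r′<a , q′>0 , good) =
  q + q′ , r′ , solve q q′ a r′ , r′<a , ≤-trans q′>0 (m≤n+m q′ q) , weaken good
  where
  solve : ∀ q q′ a r′ → q * a + 0 + (q′ * a + r′) ≡ (q + q′) * a + r′
  solve = solve-∀
  weaken : r′ ≡ 0 ⊎ a ≤ q′ + r′ → r′ ≡ 0 ⊎ a ≤ q + q′ + r′
  weaken (inj₁ r′≡0) = inj₁ r′≡0
  weaken (inj₂ a≤)   = inj₂ (≤-trans a≤ (+-monoˡ-≤ r′ (m≤n+m q′ q)))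
weaklyGood+good⇒good {a} (q , r , refl , r<a , inj₂ a≤) (q′ , .0 , refl , _ , q′>0 , inj₁ refl) =
  q + q′ , r , solve q q′ a r , r<a , ≤-trans q′>0 (m≤n+m q′ q) ,
  inj₂ (≤-trans a≤ (+-monoˡ-≤ r (subst (_≤ q + q′) (+-comm q 1) (+-monoʳ-≤ q q′>0))))
  where
  solve : ∀ q q′ a r → q * a + r + (q′ * a + 0) ≡ (q + q′) * a + r
  solve = solve-∀
weaklyGood+good⇒good {a} (q , r , refl , r<a , inj₂ a≤) (q′ , r′ , refl , r′<a , q′>0 , inj₂ a≤′)
  with r + r′ <? a
... | yes r+r′<a =
  q + q′ , r + r′ , solve q q′ a r r′ , r+r′<a , ≤-trans q′>0 (m≤n+m q′ q) ,
  inj₂ (≤-trans a≤′ (+-mono-≤ (m≤n+m q′ q) (m≤n+m r′ r)))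
  where
  solve : ∀ q q′ a r r′ → q * a + r + (q′ * a + r′) ≡ (q + q′) * a + (r + r′)
  solve = solve-∀
... | no r+r′≮a with m≤n⇒∃[o]m+o≡n (≮⇒≥ r+r′≮a)
...   | s , a+s≡r+r′ =
  suc (q + q′) , s , decomposition ,
  +-cancelˡ-< a s a (subst (_< a + a) (sym a+s≡r+r′) (+-mono-< r<a r′<a)) , s≤s z≤n ,
  inj₂ (+-cancelˡ-≤ a a _ (begin
    a + a                        ≤⟨ +-mono-≤ a≤ a≤′ ⟩
    suc (q + r) + (q′ + r′)      ≡⟨ regroup q q′ r r′ ⟩
    suc (q + q′) + (r + r′)      ≡⟨ cong (suc (q + q′) +_) (sym a+s≡r+r′) ⟩
    suc (q + q′) + (a + s)       ≡⟨ x∙yz≈y∙xz (suc (q + q′)) a s ⟩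
    a + (suc (q + q′) + s)       ∎))
  where
  open ≤-Reasoning
  regroup : ∀ q q′ r r′ → suc (q + r) + (q′ + r′) ≡ suc (q + q′) + (r + r′)
  regroup = solve-∀
  collect : ∀ q q′ a r r′ → q * a + r + (q′ * a + r′) ≡ (q + q′) * a + (r + r′)
  collect = solve-∀
  carry : ∀ p a s → p * a + (a + s) ≡ suc p * a + s
  carry = solve-∀
  decomposition : q * a + r + (q′ * a + r′) ≡ suc (q + q′) * a + s
  decomposition = trans (collect q q′ a r r′)
    (trans (cong ((q + q′) * a +_) (sym a+s≡r+r′)) (carry (q + q′) a s))

divMod : ∀ a n → 0 < a → ∃₂ λ q r → n ≡ q * a + r × r < a
divMod a n a>0 = n / a , n % a , trans (m≡m%n+[m/n]*n n a) (+-comm (n % a) _) , m%n<n n a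
  where instance _ = >-nonZero a>0

quotient-positive : ∀ {a q r} → a ≤ q * a + r → r < a → 0 < q
quotient-positive {q = zero}  a≤r r<a = contradiction a≤r (<⇒≱ r<a)
quotient-positive {q = suc _} _   _   = s≤s z≤n

quotient-≤ : ∀ {a q r q′ r′} → q * a + r ≡ q′ * a + r′ → r′ < a → q ≤ q′
quotient-≤ {a} {q} {r} {q′} {r′} eq r′<a with q ≤? q′
... | yes q≤q′ = q≤q′
... | no  q≰q′ = contradiction r′<a (≤⇒≯ (+-cancelˡ-≤ (q′ * a) a r′ (begin
    q′ * a + a    ≡⟨ +-comm (q′ * a) a ⟩
    suc q′ * a    ≤⟨ *-monoˡ-≤ a (≰⇒> q≰q′) ⟩
    q * a         ≤⟨ m≤m+n (q * a) r ⟩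
    q * a + r     ≡⟨ eq ⟩
    q′ * a + r′   ∎)))
  where open ≤-Reasoning

-- Division is unique, so the witnesses inside `Good` are the given ones.
good-divMod : ∀ {a b q r} → Good a b → b ≡ q * a + r → r < a → r ≡ 0 ⊎ a ≤ q + r
good-divMod {a} {b} {q} {r} (q′ , r′ , b≡′ , r′<a , _ , good) b≡ r<a
  with ≤-antisym (quotient-≤ {q = q} (trans (sym b≡) b≡′) r′<a)
                 (quotient-≤ {q = q′} (trans (sym b≡′) b≡) r<a)
... | refl with +-cancelˡ-≡ (q * a) r r′ (trans (sym b≡) b≡′)
...   | refl = good

-- Coins of an orderly currency are good.

module OrderlyCoins (a : ℕ) (as : List ℕ) (sorted : Linked _<_ (1 ∷ a ∷ as))
                    (ord : Orderly (1 ∷ a ∷ as)) where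

  open Greedy (a ∷ as) sorted

  a∈A : a ∈ A
  a∈A = there (here refl)

  1<a : 1 < a
  1<a = All.head (AllPairs.head A↗)

  a>0 : 0 < a
  a>0 = <⇒≤ 1<a

  coin≡1⊎≥a : ∀ {x} → x ∈ A → x ≡ 1 ⊎ a ≤ x
  coin≡1⊎≥a (here refl)         = inj₁ refl
  coin≡1⊎≥a (there (here refl)) = inj₂ ≤-refl
  coin≡1⊎≥a (there (there x∈))  = inj₂ (<⇒≤ (All.lookup (AllPairs.head (AllPairs.tail A↗)) x∈))

  -- The coins used are all below `a`, hence all equal to 1.
  sum<a⇒sum≤length : ∀ {cs} → All (_∈ A) cs → sum cs < a → sum cs ≤ length cs
  sum<a⇒sum≤length [] _ = z≤n
  sum<a⇒sum≤length {x ∷ cs} (x∈ ∷ cs⊆A) s<a with coin≡1⊎≥a x∈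
  ... | inj₁ refl = s≤s (sum<a⇒sum≤length cs⊆A (<⇒≤ s<a))
  ... | inj₂ a≤x  = contradiction (≤-trans a≤x (m≤m+n x _)) (<⇒≱ s<a)

  copies : ∀ n → Rep A (n * a) (replicate n a)
  copies n = replicate⁺ n a∈A , sum-copies n
    where
    sum-copies : ∀ n → sum (replicate n a) ≡ n * a
    sum-copies zero    = refl
    sum-copies (suc n) = cong (a +_) (sum-copies n)

  -- Greedy pays `z` and then `v` units, `v + 1` coins in all, and greedy is optimal.
  remainder<length : ∀ {z v cs} → z ∈ A → Clear A z v → v < a →
                     Rep A (z + v) cs → v < length cs
  remainder<length z∈ clear v<a rep with exchange ord z∈ clear rep
  ... | ds , (ds⊆A , refl) , len< = ≤-trans (s≤s (sum<a⇒sum≤length ds⊆A v<a)) len<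

  module BadCoin {b q r : ℕ} (b∈A : b ∈ A) (b≡ : b ≡ q * a + r)
                 (q>0 : 0 < q) (r>0 : 0 < r) (q+r<a : q + r < a)
                 (smaller-good : ∀ {e} → e < b → e ∈ A → a ≤ e → Good a e)
                 (bad : ¬ Good a b) where

    -- This width serves twice: an empty window above `z` makes `z` clear for all `v < W`, in
    -- particular for `v < a`, and a gap `d < W` leaves `b - d > r`.
    W : ℕ
    W = q * a

    a≤W : a ≤ W
    a≤W = subst (_≤ W) (+-identityʳ a) (*-monoˡ-≤ a q>0)

    WithinW : ℕ → ℕ → Set
    WithinW y z = y < z × z < y + W

    Crowded : ℕ → Set
    Crowded y = Any (WithinW y) A

    sparse⇒clear : ∀ {z v} → ¬ Crowded z → v < W → Clear A z v
    sparse⇒clear {z} {v} sparse v<W {x} x∈ x≤z+v with x ≤? z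
    ... | yes x≤z = x≤z
    ... | no  x≰z = contradiction
      (lose x∈ (≰⇒> x≰z , ≤-<-trans x≤z+v (+-monoʳ-< z v<W))) sparse

    crowded? : ∀ y → Crowded y ⊎ ¬ Crowded y
    crowded? y with any? (λ z → (y <? z) ×-dec (z <? y + W)) A
    ... | yes p = inj₁ p
    ... | no ¬p = inj₂ ¬p

    complement<a : ∀ {s v} → 0 < s → s + v ≡ a → v < a
    complement<a {s} {v} s>0 s+v≡a = subst (suc v ≤_) s+v≡a (+-monoˡ-≤ v s>0)

    -- With an empty window, greedy pays `(q + 1) a = b + (a - r)` with `1 + (a - r)` coins.
    -- Comparison with `q + 1` copies of `a` gives `a ≤ q + r`.
    b-crowded : Crowded b
    b-crowded with crowded? b
    ... | inj₁ crowded = crowded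
    ... | inj₂ sparse with m≤n⇒∃[o]m+o≡n (<⇒≤ (≤-<-trans (m≤n+m r q) q+r<a))
    ...   | v , r+v≡a = contradiction q+r<a (≤⇒≯ (begin
        a       ≡⟨ sym r+v≡a ⟩
        r + v   ≤⟨ +-monoʳ-≤ r (s≤s⁻¹ v<1+q) ⟩
        r + q   ≡⟨ +-comm r q ⟩
        q + r   ∎))
      where
      open ≤-Reasoning
      v<a : v < a
      v<a = complement<a r>0 r+v≡a
      total : suc q * a ≡ b + v
      total = trans (+-comm a W) (trans (cong (W +_) (sym r+v≡a))
        (trans (sym (+-assoc W r v)) (cong (_+ v) (sym b≡))))
      v<1+q : v < suc q
      v<1+q = subst (v <_) (length-replicate (suc q))
        (remainder<length b∈A (sparse⇒clear sparse (<-≤-trans v<a a≤W)) v<a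
          (subst (λ n → Rep A n (replicate (suc q) a)) total (copies (suc q))))

    module SparseSuccessor {y d} (y∈A : y ∈ A) (z∈A : y + d ∈ A) (d>0 : 0 < d) (d<W : d < W)
                           (sparse : ¬ Crowded (y + d)) where

      -- The coin `y` with `n` copies of `a` competes against greedy, which pays the same amount as
      -- `y + d` and `v` units.
      overshoot : ∀ n {v} → n * a ≡ d + v → v < a → v < suc n
      overshoot n {v} n*a≡ v<a = subst (λ l → v < suc l) (length-replicate n)
        (remainder<length z∈A (sparse⇒clear sparse (<-≤-trans v<a a≤W)) v<a
          (y∈A ∷ proj₁ (copies n) ,
           trans (cong (y +_) (trans (proj₂ (copies n)) n*a≡)) (sym (+-assoc y d v))))

      -- For nonzero remainder, `overshoot` is applied at `(q₁ + 1) a`, the first multiple of `a`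
      -- past `d`.
      d-weaklyGood : WeaklyGood a d
      d-weaklyGood with divMod a d a>0
      ... | q₁ , zero   , d≡ , r₁<a = q₁ , 0 , d≡ , r₁<a , inj₁ refl
      ... | q₁ , suc r₁ , d≡ , r₁<a with m≤n⇒∃[o]m+o≡n (<⇒≤ r₁<a)
      ...   | v , r₁+v≡a = q₁ , suc r₁ , d≡ , r₁<a , inj₂ (begin
          a                    ≡⟨ sym r₁+v≡a ⟩
          suc r₁ + v           ≤⟨ +-monoʳ-≤ (suc r₁) (s≤s⁻¹ (overshoot (suc q₁) total v<a)) ⟩
          suc r₁ + suc q₁      ≡⟨ +-comm (suc r₁) (suc q₁) ⟩
          suc (q₁ + suc r₁)    ∎)
        where
        open ≤-Reasoning
        v<a : v < a
        v<a = complement<a (s≤s z≤n) r₁+v≡a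
        total : suc q₁ * a ≡ d + v
        total = trans (+-comm a (q₁ * a)) (trans (cong (q₁ * a +_) (sym r₁+v≡a))
          (trans (sym (+-assoc (q₁ * a) (suc r₁) v)) (cong (_+ v) (sym d≡))))

      -- This will force `b - d < W`. If `d ≤ r`, a single copy of `a` in `overshoot` gives
      -- `a ≤ d + 1 ≤ r + q`.
      r<d : r < d
      r<d with r <? d
      ... | yes r<d = r<d
      ... | no  r≮d with m≤n⇒∃[o]m+o≡n (≤-trans (≮⇒≥ r≮d) (<⇒≤ (≤-<-trans (m≤n+m r q) q+r<a)))
      ...   | v , d+v≡a = contradiction q+r<a (≤⇒≯ (begin
          a       ≡⟨ sym d+v≡a ⟩
          d + v   ≤⟨ +-mono-≤ (≮⇒≥ r≮d) (s≤s⁻¹ (overshoot 1 (trans (+-identityʳ a) (sym d+v≡a)) (complement<a d>0 d+v≡a))) ⟩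
          r + 1   ≤⟨ +-monoʳ-≤ r q>0 ⟩
          r + q   ≡⟨ +-comm r q ⟩
          q + r   ∎))
        where open ≤-Reasoning

      absurd : ⊥
      absurd with m≤n⇒∃[o]m+o≡n (≤-trans (<⇒≤ d<W) (subst (W ≤_) (sym b≡) (m≤m+n W r)))
      -- The two coins `y` and `b` also pay `(y + d) + e`, so at most one coin is left for `e`.
      ... | e , d+e≡b = from-exchange
          (exchange ord z∈A (sparse⇒clear sparse e<W) (y∈A ∷ b∈A ∷ [] , total))
        where
        d+e≡W+r : d + e ≡ W + r
        d+e≡W+r = trans d+e≡b b≡
        e<W : e < W
        e<W = +-cancelʳ-< d e W (subst (_< W + d) (trans (sym d+e≡W+r) (+-comm d e)) (+-monoʳ-< W r<d))
        r<e : r < e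
        r<e = +-cancelˡ-< W r e (subst (_< W + e) d+e≡W+r (+-monoˡ-< e d<W))
        e<b : e < b
        e<b = subst (suc e ≤_) d+e≡b (+-monoˡ-≤ e d>0)
        total : y + (b + 0) ≡ y + d + e
        total = trans (cong (y +_) (trans (+-identityʳ b) (sym d+e≡b))) (sym (+-assoc y d e))
        from-coin : e ∈ A → ⊥
        -- Since `e > r > 0`, the coin 1 is excluded, and minimality of `b` makes `e` good.
        from-coin e∈ with coin≡1⊎≥a e∈
        ... | inj₁ refl = contradiction r>0 (≤⇒≯ (s≤s⁻¹ r<e))
        ... | inj₂ a≤e  = bad (subst (Good a) d+e≡b
          (weaklyGood+good⇒good d-weaklyGood (smaller-good e<b e∈ a≤e)))
        from-exchange : (∃ λ ds → Rep A e ds × length ds < 2) → ⊥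
        from-exchange ([] , (_ , refl) , _) with () ← r<e
        from-exchange (x ∷ [] , (x∈ ∷ [] , x+0≡e) , _) =
          from-coin (subst (_∈ A) (trans (sym (+-identityʳ x)) x+0≡e) x∈)
        from-exchange (_ ∷ _ ∷ _ , _ , s≤s (s≤s ()))

    -- Any coin in the window above `y` serves: an empty window above it is refuted by
    -- `SparseSuccessor`.
    next-crowded : ∀ {y} → y ∈ A → Crowded y → ∃ λ z → z ∈ A × y < z × Crowded z
    next-crowded {y} y∈ crowded with find crowded
    ... | z , z∈ , y<z , z<y+W with crowded? z | m≤n⇒∃[o]m+o≡n (<⇒≤ y<z)
    ...   | inj₁ z-crowded | _ = z , z∈ , y<z , z-crowded
    ...   | inj₂ sparse | d , refl = ⊥-elim (SparseSuccessor.absurd {y} {d} y∈ z∈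
      (+-cancelˡ-< y 0 d (subst (_< y + d) (sym (+-identityʳ y)) y<z))
      (+-cancelˡ-< y d W z<y+W) sparse)

    -- Infinite ascent starting from `b`.
    unbounded : ∀ n → ∃ λ y → y ∈ A × n ≤ y × Crowded y
    unbounded zero = b , b∈A , z≤n , b-crowded
    unbounded (suc n) =
      let y , y∈ , n≤y , crowded = unbounded n
          z , z∈ , y<z , z-crowded = next-crowded y∈ crowded
      in z , z∈ , ≤-<-trans n≤y y<z , z-crowded

    impossible : ⊥
    impossible =
      let y , y∈ , max<y , _ = unbounded (suc (max 0 A))
      in <⇒≱ max<y (All.lookup (xs≤max 0 A) y∈)

  -- Strong induction turns a failing `b` into a smallest bad coin.
  coins-good : ∀ b → b ∈ A → a ≤ b → Good a b
  coins-good = <-rec (λ b → b ∈ A → a ≤ b → Good a b) step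
    where
    step : ∀ b → (∀ {e} → e < b → e ∈ A → a ≤ e → Good a e) → b ∈ A → a ≤ b → Good a b
    step b smaller-good b∈ a≤b with divMod a b a>0
    ... | q , zero  , b≡ , r<a = q , 0 , b≡ , r<a , quotient-positive (subst (a ≤_) b≡ a≤b) r<a , inj₁ refl
    ... | q , suc r , b≡ , r<a with a ≤? q + suc r
    ...   | yes a≤q+r = q , suc r , b≡ , r<a , quotient-positive (subst (a ≤_) b≡ a≤b) r<a , inj₂ a≤q+r
    ...   | no  a≰q+r = ⊥-elim (BadCoin.impossible b∈ b≡
      (quotient-positive (subst (a ≤_) b≡ a≤b) r<a) (s≤s z≤n) (≰⇒> a≰q+r) smaller-good bad)
      where
      bad : ¬ Good a b
      bad good with good-divMod {q = q} good b≡ r<a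
      ... | inj₂ a≤q+r = a≰q+r a≤q+r

-- Three coins with a good third coin: greedy is optimal.

module ThreeCoins (a b : ℕ) (1<a : 1 < a) (a<b : a < b) (b-good : Good a b) where

  open Greedy (a ∷ b ∷ []) (1<a ∷ a<b ∷ [-])

  g : ℕ → ℕ
  g = grd A

  a>0 : 0 < a
  a>0 = <⇒≤ 1<a

  g-b+ : ∀ c → g (b + c) ≡ suc (g c)
  g-b+ c = grd-clear (there (there (here refl))) clear
    where
    clear : Clear A b c
    clear (here refl)                 _ = <⇒≤ (<-trans 1<a a<b)
    clear (there (here refl))         _ = <⇒≤ a<b
    clear (there (there (here refl))) _ = ≤-refl

  g-a+ : ∀ c → a + c < b → g (a + c) ≡ suc (g c)
  g-a+ c a+c<b = grd-clear (there (here refl)) clear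
    where
    clear : Clear A a c
    clear (here refl)                 _  = <⇒≤ 1<a
    clear (there (here refl))         _  = ≤-refl
    clear (there (there (here refl))) b≤ = contradiction b≤ (<⇒≱ a+c<b)

  g-<a : ∀ c → c < a → g c ≡ c
  g-<a zero    _   = refl
  g-<a (suc c) c<a = trans (grd-clear {v = c} (here refl) clear) (cong suc (g-<a c (<⇒≤ c<a)))
    where
    clear : Clear A 1 c
    clear (here refl)                 _  = ≤-refl
    clear (there (here refl))         a≤ = contradiction a≤ (<⇒≱ c<a)
    clear (there (there (here refl))) b≤ = contradiction b≤ (<⇒≱ (<-trans c<a a<b))

  g-<b : ∀ j k → k < a → j * a + k < b → g (j * a + k) ≡ j + k
  g-<b zero    k k<a _   = g-<a k k<a
  g-<b (suc j) k k<a c<b = begin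
    g (a + j * a + k)     ≡⟨ cong g (+-assoc a (j * a) k) ⟩
    g (a + (j * a + k))   ≡⟨ g-a+ (j * a + k) a+c<b ⟩
    suc (g (j * a + k))   ≡⟨ cong suc (g-<b j k k<a (≤-<-trans (m≤n+m _ a) a+c<b)) ⟩
    suc (j + k)           ∎
    where
    open ≡-Reasoning
    a+c<b : a + (j * a + k) < b
    a+c<b = subst (_< b) (+-assoc a (j * a) k) c<b

  g-coin : ∀ {x} → x ∈ A → g x ≤ 1
  g-coin (here refl) = ≤-reflexive (g-<a 1 1<a)
  g-coin (there (here refl)) = ≤-reflexive
    (trans (cong g (sym (+-identityʳ a))) (g-a+ 0 (subst (_< b) (sym (+-identityʳ a)) a<b)))
  g-coin (there (there (here refl))) = ≤-reflexive
    (trans (cong g (sym (+-identityʳ b))) (g-b+ 0))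

  -- Greedy starts with the same coin at `c` and `suc c`, except when `suc c` is itself `a` or `b`
  -- and one coin suffices; below `a` the count is the amount.
  g-suc : ∀ c → g (suc c) ≤ suc (g c)
  g-suc = <-rec (λ c → g (suc c) ≤ suc (g c)) step
    where
    step : ∀ c → (∀ {d} → d < c → g (suc d) ≤ suc (g d)) → g (suc c) ≤ suc (g c)
    step c rec with b ≤? c | a ≤? c | <-cmp (suc c) b | <-cmp (suc c) a
    ... | yes b≤c | _ | _ | _ with m≤n⇒∃[o]m+o≡n b≤c
    ...   | d , refl = begin
        g (suc (b + d))     ≡⟨ cong g (sym (+-suc b d)) ⟩
        g (b + suc d)       ≡⟨ g-b+ (suc d) ⟩
        suc (g (suc d))     ≤⟨ s≤s (rec (+-monoˡ-≤ d (<-trans a>0 a<b))) ⟩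
        suc (suc (g d))     ≡⟨ cong suc (sym (g-b+ d)) ⟩
        suc (g (b + d))     ∎
      where open ≤-Reasoning
    step c rec | no b≰c | _ | tri> _ _ b<1+c | _ = contradiction (s≤s⁻¹ b<1+c) b≰c
    step c rec | no _ | _ | tri≈ _ refl _ | _ = ≤-trans (g-coin (there (there (here refl)))) (s≤s z≤n)
    step c rec | no b≰c | yes a≤c | tri< 1+c<b _ _ | _ with m≤n⇒∃[o]m+o≡n a≤c
    ...   | d , refl = begin
        g (suc (a + d))     ≡⟨ cong g (sym (+-suc a d)) ⟩
        g (a + suc d)       ≡⟨ g-a+ (suc d) (subst (_< b) (sym (+-suc a d)) 1+c<b) ⟩
        suc (g (suc d))     ≤⟨ s≤s (rec (+-monoˡ-≤ d a>0)) ⟩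
        suc (suc (g d))     ≡⟨ cong suc (sym (g-a+ d (≰⇒> b≰c))) ⟩
        suc (g (a + d))     ∎
      where open ≤-Reasoning
    step c rec | no _ | no a≰c | tri< _ _ _ | tri> _ _ a<1+c = contradiction (s≤s⁻¹ a<1+c) a≰c
    step c rec | no _ | no _ | tri< _ _ _ | tri≈ _ refl _ = ≤-trans (g-coin (there (here refl))) (s≤s z≤n)
    step c rec | no _ | no a≰c | tri< _ _ _ | tri< 1+c<a _ _ =
      ≤-reflexive (trans (g-<a (suc c) 1+c<a) (cong suc (sym (g-<a c (≰⇒> a≰c)))))

  -- The critical case of adding a coin `a`: greedy trades `j + k` coins and the new `a` for `b` and
  -- `v` units.
  overflow-≤ : Good a b → ∀ {j k v} → v < a → suc j * a + k ≡ b + v → v ≤ j + k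
  overflow-≤ (q , r , b≡ , r<a , _ , good) {j} {k} {v} v<a b+v≡ with suc j ≤? q | trans b+v≡ (cong (_+ v) b≡)
  ... | yes j<q | eq = ≤-trans v≤k (m≤n+m k j)
    where
    open ≤-Reasoning
    v≤k : v ≤ k
    v≤k = +-cancelˡ-≤ (q * a) v k (begin
      q * a + v        ≤⟨ +-monoˡ-≤ v (m≤m+n (q * a) r) ⟩
      q * a + r + v    ≡⟨ sym eq ⟩
      suc j * a + k    ≤⟨ +-monoˡ-≤ k (*-monoˡ-≤ a j<q) ⟩
      q * a + k        ∎)
  ... | no  j≮q | eq with m≤n⇒∃[o]m+o≡n (≮⇒≥ j≮q)
  ...   | d , refl = bound d good (+-cancelˡ-≡ (q * a) _ _ (trans (expand q d a k) (trans eq (+-assoc (q * a) r v))))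
    where
    open ≤-Reasoning
    expand : ∀ q d a k → q * a + (a + (d * a + k)) ≡ suc (q + d) * a + k
    expand = solve-∀
    -- Here `j = q + d` and `q * a` is cancelled. If `r = 0` or `d > 0`, the left side is too large;
    -- for `d = 0` the inequality `a ≤ q + r` decides.
    bound : ∀ d → r ≡ 0 ⊎ a ≤ q + r → a + (d * a + k) ≡ r + v → v ≤ q + d + k
    bound d (inj₁ refl) eq′ = contradiction (subst (a ≤_) eq′ (m≤m+n a _)) (<⇒≱ v<a)
    bound (suc d) (inj₂ _) eq′ = contradiction
      (subst (a + a ≤_) eq′ (+-monoʳ-≤ a (≤-trans (m≤m+n a (d * a)) (m≤m+n _ k))))
      (<⇒≱ (+-mono-< r<a v<a))
    bound zero (inj₂ a≤q+r) eq′ = +-cancelˡ-≤ a v _ (begin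
      a + v              ≤⟨ +-monoˡ-≤ v a≤q+r ⟩
      q + r + v          ≡⟨ +-assoc q r v ⟩
      q + (r + v)        ≡⟨ cong (q +_) (sym eq′) ⟩
      q + (a + k)        ≡⟨ swap q a k ⟩
      a + (q + 0 + k)    ∎)
      where
      swap : ∀ q a k → q + (a + k) ≡ a + (q + 0 + k)
      swap = solve-∀

  g-a+≤ : ∀ c → g (a + c) ≤ suc (g c)
  g-a+≤ = <-rec (λ c → g (a + c) ≤ suc (g c)) step
    where
    step : ∀ c → (∀ {d} → d < c → g (a + d) ≤ suc (g d)) → g (a + c) ≤ suc (g c)
    step c rec with b ≤? c | a + c <? b
    ... | yes b≤c | _ with m≤n⇒∃[o]m+o≡n b≤c
    ...   | d , refl = begin
        g (a + (b + d))     ≡⟨ cong g (x∙yz≈y∙xz a b d) ⟩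
        g (b + (a + d))     ≡⟨ g-b+ (a + d) ⟩
        suc (g (a + d))     ≤⟨ s≤s (rec (+-monoˡ-≤ d (<-trans a>0 a<b))) ⟩
        suc (suc (g d))     ≡⟨ cong suc (sym (g-b+ d)) ⟩
        suc (g (b + d))     ∎
      where open ≤-Reasoning
    step c rec | no _ | yes a+c<b = ≤-reflexive (g-a+ c a+c<b)
    step c rec | no b≰c | no a+c≮b with m≤n⇒∃[o]m+o≡n (≮⇒≥ a+c≮b) | divMod a c a>0
    ...   | v , b+v≡a+c | j , k , refl , k<a = begin
        g (a + (j * a + k))    ≡⟨ cong g (sym b+v≡a+c) ⟩
        g (b + v)              ≡⟨ g-b+ v ⟩
        suc (g v)              ≡⟨ cong suc (g-<a v v<a) ⟩
        suc v                  ≤⟨ s≤s (overflow-≤ b-good {j} v<a (trans (+-assoc a (j * a) k) (sym b+v≡a+c))) ⟩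
        suc (j + k)            ≡⟨ cong suc (sym (g-<b j k k<a (≰⇒> b≰c))) ⟩
        suc (g (j * a + k))    ∎
      where
      open ≤-Reasoning
      v<a : v < a
      v<a = +-cancelˡ-< b v a
        (subst₂ _<_ (sym b+v≡a+c) (+-comm a b) (+-monoʳ-< a (≰⇒> b≰c)))

  g-coin+≤ : ∀ {x} → x ∈ A → ∀ c → g (x + c) ≤ suc (g c)
  g-coin+≤ (here refl)                 c = g-suc c
  g-coin+≤ (there (here refl))         c = g-a+≤ c
  g-coin+≤ (there (there (here refl))) c = ≤-reflexive (g-b+ c)

  -- Coins are added one at a time, each raising the greedy count by at most one.
  g-sum≤length : ∀ {cs} → All (_∈ A) cs → g (sum cs) ≤ length cs
  g-sum≤length []           = z≤n
  g-sum≤length (x∈ ∷ cs⊆A) = ≤-trans (g-coin+≤ x∈ _) (s≤s (g-sum≤length cs⊆A))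

  three-orderly : Orderly A
  three-orderly = orderly λ { _ _ (cs⊆A , refl) → g-sum≤length cs⊆A }

theorem3p5 : (k : ℕ) (A : Vec ℕ (suc k)) →
    IsCurrency (toList A) → Orderly (toList A) →
    (i₁ l : Fin (suc k)) → toℕ i₁ ≡ 1 → 2 ≤ toℕ l →
    Orderly (1 ∷ lookup A i₁ ∷ lookup A l ∷ [])
theorem3p5 _ (_ ∷ a ∷ A) (refl , sorted) ord (suc zero) (suc (suc l)) _ _ =
  -- Orderliness of the whole currency enters only through goodness of the coin `b`.
  ThreeCoins.three-orderly a b 1<a a<b (coins-good b (there (there b∈)) (<⇒≤ a<b))
  where
  open OrderlyCoins a (toList A) sorted ord
  b : ℕ
  b = lookup A l
  b∈ : b ∈ toList A
  b∈ = ∈-toList⁺ (∈-lookup l A)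
  a<b : a < b
  a<b = All.lookup (AllPairs.head (AllPairs.tail (Linked⇒AllPairs <-trans sorted))) b∈
theorem3p5 _ (_ ∷ _ ∷ _) _ _ (suc zero) (suc zero) _ (s≤s ())
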